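{- Let $k>l\ge 1$ be integers and let $n\ge k-1$ be an integer. Then $$\binom{k-1}{l}La(n-k+1,P_3,P_2)\le La(n,D_k,D_l)\le\left(\binom{k+1}{2}-k\right)\binom{k-1}{l}La(n,P_3,P_2).$$
   Context: $[n]=\{1,\dots,n\}$, and $2^{[n]}$ is the family of all subsets of $[n]$. For a finite poset $P$ and a family $\mathcal{F}$ of sets, a subfamily $\mathcal{G}\subseteq\mathcal{F}$ is a copy of $P$ in $\mathcal{F}$ if there is a bijection $\phi:P\to\mathcal{G}$ such that $x\le_P x'$ implies $\phi(x)\subseteq\phi(x')$ (the converse implication is not required). $c(P,\mathcal{F})$ denotes the number of copies of $P$ in $\mathcal{F}$ (i.e. the number of such subfamilies $\mathcal{G}$). For posets $P,Q$, $La(n,P,Q)=\max\{c(Q,\mathcal{F}):\mathcal{F}\subseteq 2^{[n]},\ c(P,\mathcal{F})=0\}$. $P_k$ is the chain on $k$ elements. The generalized diamond $D_k$ has $k+2$ elements $a,b_1,\dots,b_k,c$ with $a<b_1,\dots,b_k<c$. -}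

module Defs where

open import Data.Fin.Base using (Fin; zero; suc; fromℕ; finToFun; funToFin)
import Data.Fin.Base as Fin
import Data.Fin.Properties as Fin
open import Data.Fin.Subset using (Subset; inside; outside; _∈_; _⊆_)
open import Data.Fin.Subset.Properties using (_∈?_; _⊆?_)
open import Data.List.Base using (List; [_]; _++_; map; filter; length; lookup)
open import Data.List.Extrema.Nat using (max)
import Data.List.Membership.Propositional as List
open import Data.List.Membership.Propositional.Properties using (∈-map⁺; ∈-map⁻; ∈-++⁺ˡ; ∈-++⁺ʳ)
open import Data.List.Relation.Unary.All using ([])
open import Data.List.Relation.Unary.AllPairs using ([]; _∷_)
open import Data.List.Relation.Unary.Any using (here)
open import Data.List.Relation.Unary.Unique.Propositional using (Unique)
import Data.List.Relation.Unary.Unique.Propositional.Properties as Unique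
open import Data.Nat.Base using (ℕ; zero; suc)
open import Data.Nat.Properties using (_≟_)
open import Data.Bool.Properties using () renaming (_≟_ to _≟ᵇ_)
open import Data.Product.Base using (∃; _×_; _,_; proj₁; proj₂)
open import Data.Vec.Base using ([]; _∷_)
open import Data.Vec.Properties using (≡-dec; ∷-injectiveʳ)
open import Function.Base using (_on_)
open import Function.Definitions using (Bijective)
open import Level using (0ℓ)
open import Relation.Binary.Core using (Rel)
open import Relation.Binary.Definitions using (Reflexive; Transitive; Antisymmetric; Decidable; DecidableEquality)
open import Relation.Binary.PropositionalEquality using (_≡_; refl; sym; trans; cong; subst; subst₂; isEquivalence)
open import Relation.Binary.Structures using (IsDecPartialOrder; IsDecTotalOrder)
open import Relation.Nullary.Decidable using (Dec; yes; no; map′; _×-dec_; _→-dec_)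

record FinitePoset : Set₁ where
  infix 4 _≼_
  field
    size              : ℕ
    _≼_               : Rel (Fin size) 0ℓ
    isDecPartialOrder : IsDecPartialOrder _≡_ _≼_

  open IsDecPartialOrder isDecPartialOrder public
    using () renaming (_≤?_ to _≼?_)

chain : ℕ → FinitePoset
chain k = record
  { size              = k
  ; _≼_               = Fin._≤_
  ; isDecPartialOrder = IsDecTotalOrder.isDecPartialOrder Fin.≤-isDecTotalOrder
  }

-- The elements a, b₁, …, b_k, c of the generalized diamond are
-- 0, 1, …, k, k + 1 respectively.

data Diamond≤ (k : ℕ) : Rel (Fin (suc (suc k))) 0ℓ where
  ≤-refl : ∀ {x} → Diamond≤ k x x
  a≤     : ∀ {x} → Diamond≤ k zero x
  ≤c     : ∀ {x} → Diamond≤ k x (fromℕ (suc k))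

private
  diamond-trans : ∀ {k} → Transitive (Diamond≤ k)
  diamond-trans ≤-refl q      = q
  diamond-trans a≤     _      = a≤
  diamond-trans ≤c     ≤-refl = ≤c
  diamond-trans ≤c     ≤c     = ≤c

  diamond-antisym : ∀ {k} → Antisymmetric _≡_ (Diamond≤ k)
  diamond-antisym ≤-refl _      = refl
  diamond-antisym a≤     ≤-refl = refl
  diamond-antisym a≤     a≤     = refl
  diamond-antisym ≤c     ≤-refl = refl
  diamond-antisym ≤c     ≤c     = refl

  diamond? : ∀ {k} → Decidable (Diamond≤ k)
  diamond? {k} x y with x Fin.≟ y | x Fin.≟ zero | y Fin.≟ fromℕ (suc k)
  ... | yes refl | _        | _        = yes ≤-refl
  ... | no _     | yes refl | _        = yes a≤
  ... | no _     | no _     | yes refl = yes ≤c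
  ... | no x≢y   | no x≢a   | no y≢c   =
    no λ { ≤-refl → x≢y refl ; a≤ → x≢a refl ; ≤c → y≢c refl }

diamond : ℕ → FinitePoset
diamond k = record
  { size              = suc (suc k)
  ; _≼_               = Diamond≤ k
  ; isDecPartialOrder = record
    { isPartialOrder = record
      { isPreorder = record
        { isEquivalence = isEquivalence
        ; reflexive     = λ { refl → ≤-refl }
        ; trans         = diamond-trans
        }
      ; antisym = diamond-antisym
      }
    ; _≟_  = Fin._≟_
    ; _≤?_ = diamond?
    }
  }

subsets : ∀ n → List (Subset n)
subsets zero    = [ [] ]
subsets (suc n) = map (outside ∷_) (subsets n) ++ map (inside ∷_) (subsets n)

subsets-complete : ∀ {n} (A : Subset n) → A List.∈ subsets n
subsets-complete []            = here refl
subsets-complete (outside ∷ A) = ∈-++⁺ˡ (∈-map⁺ (outside ∷_) (subsets-complete A))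
subsets-complete (inside  ∷ A) =
  ∈-++⁺ʳ (map (outside ∷_) (subsets _)) (∈-map⁺ (inside ∷_) (subsets-complete A))

subsets-unique : ∀ n → Unique (subsets n)
subsets-unique zero    = [] ∷ []
subsets-unique (suc n) = Unique.++⁺
  (Unique.map⁺ ∷-injectiveʳ (subsets-unique n))
  (Unique.map⁺ ∷-injectiveʳ (subsets-unique n))
  λ (p , q) → disjoint (proj₂ (proj₂ (∈-map⁻ _ p))) (proj₂ (proj₂ (∈-map⁻ _ q)))
  where
  disjoint : ∀ {C : Subset (suc n)} {A B : Subset n} {X : Set} →
             C ≡ outside ∷ A → C ≡ inside ∷ B → X
  disjoint refl ()

-- A family F ⊆ 2^[n] is given by the set of positions of its members in
-- the repetition-free enumeration `subsets n`.  Families with the same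
-- members are thus propositionally equal, and each family occurs exactly
-- once in `families n`.

record Family (n : ℕ) : Set where
  constructor family
  field positions : Subset (length (subsets n))

open Family public

families : ∀ n → List (Family n)
families n = map family (subsets (length (subsets n)))

infix 4 _∈ᶠ_ _⊆ᶠ_
_∈ᶠ_ : ∀ {n} → Subset n → Family n → Set
_∈ᶠ_ {n} A F = ∃ λ i → i ∈ positions F × lookup (subsets n) i ≡ A

_⊆ᶠ_ : ∀ {n} → Rel (Family n) 0ℓ
G ⊆ᶠ F = positions G ⊆ positions F

_⊆ᶠ?_ : ∀ {n} → Decidable (_⊆ᶠ_ {n})
G ⊆ᶠ? F = positions G ⊆? positions F

-- φ need not reflect the order, so copies are not necessarily induced.

IsCopy : ∀ {n} → FinitePoset → Family n → Set
IsCopy P G = ∃ λ (φ : Fin size → ∃ λ A → A ∈ᶠ G) →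
  Bijective _≡_ (_≡_ on proj₁) φ ×
  (∀ x x′ → x ≼ x′ → proj₁ (φ x) ⊆ proj₁ (φ x′))
  where open FinitePoset P

-- Decided by searching through all maps from P to positions in `subsets n`.

isCopy? : ∀ {n} (P : FinitePoset) (G : Family n) → Dec (IsCopy P G)
isCopy? {n} P G = map′ to from (Fin.any? λ j → good? (finToFun j))
  where
  open FinitePoset P

  N : ℕ
  N = length (subsets n)

  set : Fin N → Subset n
  set = lookup (subsets n)

  _≟ˢ_ : DecidableEquality (Subset n)
  _≟ˢ_ = ≡-dec _≟ᵇ_

  Good : (Fin size → Fin N) → Set
  Good ψ =
    (∀ x → ψ x ∈ positions G) ×
    (∀ x y → set (ψ x) ≡ set (ψ y) → x ≡ y) ×
    (∀ i → i ∈ positions G → ∃ λ x → set (ψ x) ≡ set i) ×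
    (∀ x y → x ≼ y → set (ψ x) ⊆ set (ψ y))

  good? : ∀ ψ → Dec (Good ψ)
  good? ψ =
    Fin.all? (λ x → ψ x ∈? positions G) ×-dec
    Fin.all? (λ x → Fin.all? λ y → (set (ψ x) ≟ˢ set (ψ y)) →-dec (x Fin.≟ y)) ×-dec
    Fin.all? (λ i → (i ∈? positions G) →-dec Fin.any? λ x → set (ψ x) ≟ˢ set i) ×-dec
    Fin.all? (λ x → Fin.all? λ y → (x ≼? y) →-dec (set (ψ x) ⊆? set (ψ y)))

  good-resp : ∀ {ψ χ} → (∀ x → ψ x ≡ χ x) → Good ψ → Good χ
  good-resp ψ≗χ (mem , inj , sur , mon) =
    (λ x → subst (_∈ positions G) (ψ≗χ x) (mem x)) ,
    (λ x y e → inj x y (trans (cong set (ψ≗χ x)) (trans e (cong set (sym (ψ≗χ y)))))) ,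
    (λ i i∈G → let x , e = sur i i∈G in x , trans (cong set (sym (ψ≗χ x))) e) ,
    (λ x y x≼y → subst₂ (λ i j → set i ⊆ set j) (ψ≗χ x) (ψ≗χ y) (mon x y x≼y))

  to : (∃ λ j → Good (finToFun j)) → IsCopy P G
  to (j , mem , inj , sur , mon) =
    (λ x → set (finToFun j x) , finToFun j x , mem x , refl) ,
    ((λ e → inj _ _ e) ,
     λ { (_ , i , i∈G , refl) → let x , e = sur i i∈G in x , λ { refl → e } }) ,
    mon

  from : IsCopy P G → ∃ λ j → Good (finToFun j)
  from (φ , (inj , sur) , mon) =
    funToFin ψ , good-resp (λ x → sym (Fin.finToFun-funToFin ψ x))
      ( (λ x → proj₁ (proj₂ (proj₂ (φ x))))
      , (λ x y e → inj (trans (sym (set-ψ x)) (trans e (set-ψ y))))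
      , (λ i i∈G → let x , e = sur (set i , i , i∈G , refl) in x , trans (set-ψ x) (e refl))
      , (λ x y x≼y → subst₂ _⊆_ (sym (set-ψ x)) (sym (set-ψ y)) (mon x y x≼y)) )
    where
    ψ : Fin size → Fin N
    ψ x = proj₁ (proj₂ (φ x))

    set-ψ : ∀ x → set (ψ x) ≡ proj₁ (φ x)
    set-ψ x = proj₂ (proj₂ (proj₂ (φ x)))

-- Copies are counted as subfamilies, irrespective of the number of maps φ.

c : ∀ {n} → FinitePoset → Family n → ℕ
c {n} P F = length (filter (λ G → (G ⊆ᶠ? F) ×-dec isCopy? P G) (families n))

-- The default value 0 is the maximum over no families at all; this occurs
-- only for the empty poset P, as otherwise F = ∅ contains no copy of P.

La : ℕ → FinitePoset → FinitePoset → ℕ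
La n P Q = max 0 (map (c Q) (filter (λ F → c P F ≟ 0) (families n)))

{-# OPTIONS --safe #-}
module Submission where

-- A copy of D_l in F has a least member A and a greatest member B, so
-- c(D_l, F) = Σ (m(A, B) C l) over the pairs A ⊊ B in F, where m(A, B) is the
-- number of members of F strictly between A and B; P₂ and P₃ are D₀ and D₁.
-- In particular F is D_k-free iff m(A, B) < k for all such pairs.
--
-- Upper bound: a D_k-free family has no chain of k + 2 members, so it splits
-- into k + 1 antichains by height.  A pair with m(A, B) > 0 has heights
-- differing by at least 2, and the union of two antichains is P₃-free.  There
-- are (k + 1 C 2) ∸ k pairs of such heights, and each pair (A, B) carries at
-- most (k ∸ 1 C l) copies.
--
-- Lower bound: let K = k ∸ 1 and let F on n ∸ K points be P₃-free.  On K new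
-- points, replace every A lying below another member by A and the K sets
-- A ∪ {i}, and every B lying above another member by B ∪ [K].  For A ⊊ B
-- in F exactly the K sets A ∪ {i} lie strictly between A and B ∪ [K], and no
-- pair has more than K members between.

open import Defs
open import Data.Nat using (ℕ; _+_; _*_; _∸_; _≤_; _<_)
open import Data.Nat.Combinatorics using (_C_)
open import Data.Product using (_×_)

open import Data.Bool.Properties using () renaming (_≟_ to _≟ᵇ_)
open import Data.Empty using (⊥-elim)
open import Data.Fin.Base using (Fin; zero; suc; fromℕ; inject₁)
import Data.Fin.Base as Fin
import Data.Fin.Properties as Fin
open import Data.Fin.Relation.Unary.Top using (view; ‵fromℕ; ‵inject₁; view-fromℕ; view-inject₁)
open import Data.Fin.Subset using (Subset; inside; outside; _∈_; _⊆_; _∪_; ⁅_⁆; ⊤; ⊥; ∣_∣; Nonempty)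
open import Data.Fin.Subset.Properties
  using (_∈?_; _⊆?_; nonempty?; ⊆-antisym; ⊆-trans; x∈⁅x⁆; x∈⁅y⁆⇒x≡y; x∈p∪q⁺; x∈p∪q⁻; ∉⊥; ∈⊤; ⊆-min; ⊆-max; ∣⊥∣≡0; drop-∷-⊆; p⊂q⇒∣p∣<∣q∣)
open import Data.List.Base using (List; []; _∷_; [_]; _++_; map; filter; length; lookup; concatMap; cartesianProduct; allFin; upTo)
open import Data.List.Extrema.Nat using (xs≤max; argmax-all)
import Data.List.Membership.Propositional as List
open import Data.List.Membership.Propositional.Properties
  using (∈-map⁺; ∈-map⁻; ∈-++⁺ˡ; ∈-++⁺ʳ; ∈-++⁻; ∈-filter⁺; ∈-filter⁻; ∈-lookup; ∈-cartesianProduct⁺; ∈-allFin; ∈-concatMap⁺; ∈-concatMap⁻; ∈-upTo⁺)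
open import Data.List.Properties using (map-cong; length-map; length-++; length-upTo; filter-≐)
import Data.List.Relation.Unary.All as All
import Data.List.Relation.Unary.All.Properties as All
open import Data.List.Relation.Unary.AllPairs using ([]; _∷_)
import Data.List.Relation.Unary.Any as Any
open import Data.List.Relation.Unary.Any using (here; there)
open import Data.List.Relation.Unary.Any.Properties using (lookup-index)
open import Data.List.Relation.Unary.Unique.Propositional using (Unique)
import Data.List.Relation.Unary.Unique.Propositional.Properties as Unique
open import Data.Nat using (zero; suc; z≤n; s≤s; _≤?_; _≤′_; ≤′-reflexive; ≤′-step)
open import Data.Nat.ListAction using (sum)
import Data.Nat.Properties as ℕ
open import Data.Nat.Combinatorics using (nCk+nC[k+1]≡[n+1]C[k+1]; k>n⇒nCk≡0; nCn≡1; nC1≡n)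
open import Data.Product using (∃; _,_; proj₁; proj₂)
open import Data.Sum using (_⊎_; inj₁; inj₂)
open import Data.Vec.Base as Vec using ([]; _∷_; here; there)
import Data.Vec.Properties as Vec
open import Function.Base using (_∘_; case_of_)
open import Relation.Binary.PropositionalEquality
  using (_≡_; _≢_; refl; sym; trans; cong; cong₂; subst; subst₂)
open import Relation.Nullary using (¬_; Dec; yes; no; does; ¬?; _×-dec_; _⊎-dec_)
open import Relation.Nullary.Decidable using (dec-true)
open import Relation.Unary using (Decidable)

-- Repetition-free lists and sums over lists.

lookup-injective : ∀ {A : Set} {xs : List A} → Unique xs →
                   ∀ i j → lookup xs i ≡ lookup xs j → i ≡ j
lookup-injective (_ ∷ _)    zero    zero    _ = refl
lookup-injective (x∉ ∷ _)   zero    (suc j) e = ⊥-elim (All.lookup x∉ (∈-lookup j) e)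
lookup-injective (x∉ ∷ _)   (suc i) zero    e = ⊥-elim (All.lookup x∉ (∈-lookup i) (sym e))
lookup-injective (_ ∷ xs!)  (suc i) (suc j) e = cong suc (lookup-injective xs! i j e)

unique-⊆⇒length≤ : ∀ {A : Set} {xs ys : List A} → Unique xs →
                   (∀ {x} → x List.∈ xs → x List.∈ ys) → length xs ≤ length ys
unique-⊆⇒length≤ {xs = xs} {ys} xs! xs⊆ys = Fin.injective⇒≤ {f = position} λ {i} {j} e →
  lookup-injective xs! i j
    (trans (lookup-index (xs⊆ys (∈-lookup i)))
    (trans (cong (lookup ys) e) (sym (lookup-index (xs⊆ys (∈-lookup j))))))
  where
  position : Fin (length xs) → Fin (length ys)
  position i = Any.index (xs⊆ys (∈-lookup i))

-- The last hypothesis says that blocks with a common entry have the same index; as the indices do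
-- not repeat, distinct blocks are disjoint.
concatMap-unique : ∀ {A B : Set} (f : A → List B) {xs} → Unique xs →
  (∀ x → Unique (f x)) →
  (∀ {x y v} → x List.∈ xs → y List.∈ xs → v List.∈ f x → v List.∈ f y → x ≡ y) →
  Unique (concatMap f xs)
concatMap-unique f []          _   _   = []
concatMap-unique f {x ∷ xs} (x∉ ∷ xs!) fx! sep = Unique.++⁺ (fx! x)
  (concatMap-unique f xs! fx! (λ x∈ y∈ → sep (there x∈) (there y∈)))
  λ (v∈fx , v∈rest) →
    let y , y∈ , v∈fy = List.find (∈-concatMap⁻ f {xs = xs} v∈rest)
    in All.lookup x∉ y∈ (sep (here refl) (there y∈) v∈fx v∈fy)

length-concatMap : ∀ {A B : Set} (f : A → List B) xs →
                   length (concatMap f xs) ≡ sum (map (length ∘ f) xs)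
length-concatMap f []       = refl
length-concatMap f (x ∷ xs) = trans (length-++ (f x)) (cong (length (f x) +_) (length-concatMap f xs))

module _ {A : Set} {P : A → Set} (P? : Decidable P) (f : A → ℕ) (b : ℕ) where

  -- For the upper bound, `P` singles out the pairs with some member between; all other pairs
  -- contribute 0.
  sum-map≤ : ∀ xs → (∀ {x} → x List.∈ xs → f x ≤ b) → (∀ {x} → ¬ P x → f x ≡ 0) →
             sum (map f xs) ≤ b * length (filter P? xs)
  sum-map≤ []       _  _  = z≤n
  sum-map≤ (x ∷ xs) ≤b f0 with P? x
  ... | yes _ = ℕ.≤-trans (ℕ.+-mono-≤ (≤b (here refl)) (sum-map≤ xs (≤b ∘ there) f0))
                          (ℕ.≤-reflexive (sym (ℕ.*-suc b _)))
  ... | no ¬p rewrite f0 ¬p = sum-map≤ xs (≤b ∘ there) f0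

  -- For the lower bound, `P` singles out the pairs with many members between; the terms of all
  -- other pairs are discarded.
  ≤sum-map : ∀ xs → (∀ {x} → P x → b ≤ f x) → b * length (filter P? xs) ≤ sum (map f xs)
  ≤sum-map []       _  = ℕ.≤-reflexive (ℕ.*-zeroʳ b)
  ≤sum-map (x ∷ xs) b≤ with P? x
  ... | yes p = ℕ.≤-trans (ℕ.≤-reflexive (ℕ.*-suc b _)) (ℕ.+-mono-≤ (b≤ p) (≤sum-map xs b≤))
  ... | no  _ = ℕ.≤-trans (≤sum-map xs b≤) (ℕ.m≤n+m _ (f x))

sum-map≡0⇒ : ∀ {A : Set} (f : A → ℕ) {xs x} → sum (map f xs) ≡ 0 → x List.∈ xs → f x ≡ 0
sum-map≡0⇒ f {x ∷ xs} e (here refl) = ℕ.m+n≡0⇒m≡0 (f x) e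
sum-map≡0⇒ f {x ∷ xs} e (there x∈)  = sum-map≡0⇒ f (ℕ.m+n≡0⇒n≡0 (f x) e) x∈

sum-map≤length* : ∀ {A : Set} (f : A → ℕ) b xs → (∀ {x} → x List.∈ xs → f x ≤ b) →
                  sum (map f xs) ≤ length xs * b
sum-map≤length* f b []       _  = z≤n
sum-map≤length* f b (x ∷ xs) ≤b = ℕ.+-mono-≤ (≤b (here refl)) (sum-map≤length* f b xs (≤b ∘ there))

-- Monotonicity of binomial coefficients.

nC0≡1 : ∀ n → n C 0 ≡ 1
nC0≡1 zero    = refl
nC0≡1 (suc n) = refl

C-stepˡ : ∀ n k → n C k ≤ suc n C k
C-stepˡ n zero    = ℕ.≤-reflexive (trans (nC0≡1 n) (sym (nC0≡1 (suc n))))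
C-stepˡ n (suc k) = ℕ.≤-trans (ℕ.m≤n+m _ (n C k)) (ℕ.≤-reflexive (nCk+nC[k+1]≡[n+1]C[k+1] n k))

C-monoˡ : ∀ k {m n} → m ≤ n → m C k ≤ n C k
C-monoˡ k m≤n = go (ℕ.≤⇒≤′ m≤n)
  where
  go : ∀ {m n} → m ≤′ n → m C k ≤ n C k
  go (≤′-reflexive refl) = ℕ.≤-refl
  go (≤′-step m≤′n)      = ℕ.≤-trans (go m≤′n) (C-stepˡ _ k)

-- Subsets: proper inclusion, concatenation, comprehension, enumeration.

infix 4 _⊊_
_⊊_ : ∀ {n} → Subset n → Subset n → Set
A ⊊ B = A ⊆ B × A ≢ B

⊊-trans : ∀ {n} {A B D : Subset n} → A ⊊ B → B ⊊ D → A ⊊ D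
⊊-trans (A⊆B , A≢B) (B⊆D , _) = ⊆-trans A⊆B B⊆D , λ { refl → A≢B (⊆-antisym A⊆B B⊆D) }

_≟ˢ_ : ∀ {n} (A B : Subset n) → Dec (A ≡ B)
_≟ˢ_ = Vec.≡-dec _≟ᵇ_

_⊊?_ : ∀ {n} (A B : Subset n) → Dec (A ⊊ B)
A ⊊? B = (A ⊆? B) ×-dec ¬? (A ≟ˢ B)

++-⊆⁺ : ∀ {m n} (A A′ : Subset m) {B B′ : Subset n} → A ⊆ A′ → B ⊆ B′ → A Vec.++ B ⊆ A′ Vec.++ B′
++-⊆⁺ []      []        _    B⊆B′ x∈        = B⊆B′ x∈
++-⊆⁺ (_ ∷ A) (_ ∷ A′) A⊆A′ B⊆B′ here with A⊆A′ here
... | here = here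
++-⊆⁺ (_ ∷ A) (_ ∷ A′) A⊆A′ B⊆B′ (there x∈) = there (++-⊆⁺ A A′ (drop-∷-⊆ A⊆A′) B⊆B′ x∈)

++-⊆⁻ : ∀ {m n} (A A′ : Subset m) {B B′ : Subset n} → A Vec.++ B ⊆ A′ Vec.++ B′ → A ⊆ A′ × B ⊆ B′
++-⊆⁻ []      []        AB⊆ = (λ ()) , AB⊆
++-⊆⁻ (x ∷ A) (x′ ∷ A′) {B} {B′} AB⊆ = head⊆ , proj₂ rest
  where
  rest : A ⊆ A′ × B ⊆ B′
  rest = ++-⊆⁻ A A′ (drop-∷-⊆ AB⊆)
  head⊆ : x ∷ A ⊆ x′ ∷ A′
  head⊆ here with AB⊆ here
  ... | here = here
  head⊆ (there y∈) = there (proj₁ rest y∈)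

module _ {n : ℕ} {P : Fin n → Set} (P? : Decidable P) where

  comprehension : Subset n
  comprehension = Vec.tabulate (does ∘ P?)

  ∈-comprehension⁺ : ∀ {x} → P x → x ∈ comprehension
  ∈-comprehension⁺ {x} p = Vec.lookup⇒[]= x _ (trans (Vec.lookup∘tabulate (does ∘ P?) x) (dec-true (P? x) p))

  ∈-comprehension⁻ : ∀ {x} → x ∈ comprehension → P x
  ∈-comprehension⁻ {x} x∈ with P? x | trans (sym (Vec.lookup∘tabulate (does ∘ P?) x)) (Vec.[]=⇒lookup x∈)
  ... | yes p | _ = p

-- The increasing enumeration of `S`. It is a bijection from `Fin ∣ S ∣`, so bounds on `∣ S ∣`
-- reduce to injections between types `Fin`.
nth : ∀ {n} (S : Subset n) → Fin ∣ S ∣ → Fin n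
nth (outside ∷ S) i       = suc (nth S i)
nth (inside  ∷ S) zero    = zero
nth (inside  ∷ S) (suc i) = suc (nth S i)

nth-∈ : ∀ {n} (S : Subset n) i → nth S i ∈ S
nth-∈ (outside ∷ S) i       = there (nth-∈ S i)
nth-∈ (inside  ∷ S) zero    = here
nth-∈ (inside  ∷ S) (suc i) = there (nth-∈ S i)

nth-injective : ∀ {n} (S : Subset n) {i j} → nth S i ≡ nth S j → i ≡ j
nth-injective (outside ∷ S) {i}     {j}     e = nth-injective S (Fin.suc-injective e)
nth-injective (inside  ∷ S) {zero}  {zero}  e = refl
nth-injective (inside  ∷ S) {suc i} {suc j} e = cong suc (nth-injective S (Fin.suc-injective e))

nth-surjective : ∀ {n} (S : Subset n) {x} → x ∈ S → ∃ λ i → nth S i ≡ x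
nth-surjective (outside ∷ S) (there x∈) = let i , e = nth-surjective S x∈ in i , cong suc e
nth-surjective (inside  ∷ S) here       = zero , refl
nth-surjective (inside  ∷ S) (there x∈) = let i , e = nth-surjective S x∈ in suc i , cong suc e

injection⇒≤∣∣ : ∀ {m n} (S : Subset n) (g : Fin m → Fin n) → (∀ i → g i ∈ S) →
                (∀ {i j} → g i ≡ g j → i ≡ j) → m ≤ ∣ S ∣
injection⇒≤∣∣ S g g∈ g-inj = Fin.injective⇒≤ {f = λ i → proj₁ (nth-surjective S (g∈ i))} λ {i} {j} e →
  g-inj (trans (sym (proj₂ (nth-surjective S (g∈ i))))
        (trans (cong (nth S) e) (proj₂ (nth-surjective S (g∈ j)))))

-- Choosing a preimage of each member of `S` is injective, because `g` recovers the member. With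
-- `m = 0` this shows that a set without members has size 0.
surjection⇒∣∣≤ : ∀ {m n} (S : Subset n) (g : Fin m → Fin n) →
                 (∀ {x} → x ∈ S → ∃ λ i → g i ≡ x) → ∣ S ∣ ≤ m
surjection⇒∣∣≤ S g g-sur = Fin.injective⇒≤ {f = λ i → proj₁ (g-sur (nth-∈ S i))} λ {i} {j} e →
  nth-injective S (trans (sym (proj₂ (g-sur (nth-∈ S i))))
                  (trans (cong g e) (proj₂ (g-sur (nth-∈ S j)))))

-- The subsets of a given size.

choose : ∀ {n} → Subset n → ℕ → List (Subset n)
choose M             zero    = [ ⊥ ]
choose []            (suc l) = []
choose (outside ∷ M) (suc l) = map (outside ∷_) (choose M (suc l))
choose (inside  ∷ M) (suc l) = map (outside ∷_) (choose M (suc l)) ++ map (inside ∷_) (choose M l)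

-- Pascal's rule at the first point of `M`: the sets that avoid it and the sets that contain it.
length-choose : ∀ {n} (M : Subset n) l → length (choose M l) ≡ ∣ M ∣ C l
length-choose M             zero    = sym (nC0≡1 ∣ M ∣)
length-choose []            (suc l) = sym (k>n⇒nCk≡0 {0} {suc l} (s≤s z≤n))
length-choose (outside ∷ M) (suc l) = trans (length-map (outside ∷_) (choose M (suc l))) (length-choose M (suc l))
length-choose (inside  ∷ M) (suc l) =
  trans (length-++ (map (outside ∷_) (choose M (suc l))))
  (trans (cong₂ _+_ (trans (length-map _ (choose M (suc l))) (length-choose M (suc l)))
                    (trans (length-map _ (choose M l)) (length-choose M l)))
  (trans (ℕ.+-comm (∣ M ∣ C suc l) (∣ M ∣ C l)) (nCk+nC[k+1]≡[n+1]C[k+1] ∣ M ∣ l)))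

choose-sound : ∀ {n} (M : Subset n) l {S} → S List.∈ choose M l → S ⊆ M × ∣ S ∣ ≡ l
choose-sound {n} M         zero    (here refl) = ⊆-min M , ∣⊥∣≡0 n
choose-sound (outside ∷ M) (suc l) S∈ with ∈-map⁻ (outside ∷_) S∈
... | _ , S∈′ , refl = let S⊆M , e = choose-sound M (suc l) S∈′ in (λ { (there x∈) → there (S⊆M x∈) }) , e
choose-sound (inside  ∷ M) (suc l) S∈ with ∈-++⁻ (map (outside ∷_) (choose M (suc l))) S∈
... | inj₁ S∈₁ with ∈-map⁻ (outside ∷_) S∈₁
...   | _ , S∈′ , refl = let S⊆M , e = choose-sound M (suc l) S∈′ in (λ { (there x∈) → there (S⊆M x∈) }) , e
choose-sound (inside  ∷ M) (suc l) S∈ | inj₂ S∈₂ with ∈-map⁻ (inside ∷_) S∈₂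
...   | _ , S∈′ , refl = let S⊆M , e = choose-sound M l S∈′ in (λ { here → here ; (there x∈) → there (S⊆M x∈) }) , cong suc e

∣S∣≡0⇒S≡⊥ : ∀ {n} (S : Subset n) → ∣ S ∣ ≡ 0 → S ≡ ⊥
∣S∣≡0⇒S≡⊥ []            _ = refl
∣S∣≡0⇒S≡⊥ (outside ∷ S) e = cong (outside ∷_) (∣S∣≡0⇒S≡⊥ S e)

choose-complete : ∀ {n} {S M : Subset n} l → S ⊆ M → ∣ S ∣ ≡ l → S List.∈ choose M l
choose-complete {S = S} {M} zero _ e = here (∣S∣≡0⇒S≡⊥ S e)
choose-complete {S = outside ∷ S} {outside ∷ M} (suc l) S⊆M e = ∈-map⁺ (outside ∷_) (choose-complete (suc l) (drop-∷-⊆ S⊆M) e)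
choose-complete {S = outside ∷ S} {inside  ∷ M} (suc l) S⊆M e = ∈-++⁺ˡ (∈-map⁺ (outside ∷_) (choose-complete (suc l) (drop-∷-⊆ S⊆M) e))
choose-complete {S = inside  ∷ S} {inside  ∷ M} (suc l) S⊆M e =
  ∈-++⁺ʳ (map (outside ∷_) (choose M (suc l))) (∈-map⁺ (inside ∷_) (choose-complete l (drop-∷-⊆ S⊆M) (ℕ.suc-injective e)))
choose-complete {S = inside  ∷ S} {outside ∷ M} (suc l) S⊆M e with S⊆M here
... | ()

choose-unique : ∀ {n} (M : Subset n) l → Unique (choose M l)
choose-unique M             zero    = All.[] ∷ []
choose-unique []            (suc l) = []
choose-unique (outside ∷ M) (suc l) = Unique.map⁺ Vec.∷-injectiveʳ (choose-unique M (suc l))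
choose-unique (inside  ∷ M) (suc l) = Unique.++⁺
  (Unique.map⁺ Vec.∷-injectiveʳ (choose-unique M (suc l)))
  (Unique.map⁺ Vec.∷-injectiveʳ (choose-unique M l))
  λ (p , q) → case trans (sym (proj₂ (proj₂ (∈-map⁻ _ p)))) (proj₂ (proj₂ (∈-map⁻ _ q))) of λ ()

-- Tells the roles a, b₁, ..., b_l, c apart. The index of c is `fromℕ (suc l)`, which matching on
-- `suc` cannot separate from the index of some b_i.
data DiamondView {l : ℕ} : Fin (suc (suc l)) → Set where
  bottom : DiamondView zero
  middle : ∀ i → DiamondView (suc (inject₁ i))
  top    : DiamondView (fromℕ (suc l))

diamondView : ∀ {l} (x : Fin (suc (suc l))) → DiamondView x
diamondView zero = bottom
diamondView (suc x) with view x
... | ‵fromℕ     = top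
... | ‵inject₁ i = middle i

diamondView-top : ∀ l → diamondView (fromℕ (suc l)) ≡ top
diamondView-top l rewrite view-fromℕ l = refl

diamondView-middle : ∀ {l} (i : Fin l) → diamondView (suc (inject₁ i)) ≡ middle i
diamondView-middle i rewrite view-inject₁ i = refl

-- Members of families as positions, and copies as maps into positions.

module Ground (n : ℕ) where

  Position : Set
  Position = Fin (length (subsets n))

  set : Position → Subset n
  set = lookup (subsets n)

  set-injective : ∀ {i j} → set i ≡ set j → i ≡ j
  set-injective {i} {j} = lookup-injective (subsets-unique n) i j

  position : Subset n → Position
  position A = Any.index (subsets-complete A)

  set-position : ∀ A → set (position A) ≡ A
  set-position A = sym (lookup-index (subsets-complete A))

  infix 4 _⊏_ _⊏?_
  _⊏_ : Position → Position → Set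
  i ⊏ j = set i ⊊ set j

  _⊏?_ : ∀ i j → Dec (i ⊏ j)
  i ⊏? j = set i ⊊? set j

  ⊆∧≢⇒⊏ : ∀ {i j} → set i ⊆ set j → i ≢ j → i ⊏ j
  ⊆∧≢⇒⊏ i⊆j i≢j = i⊆j , i≢j ∘ set-injective

  module _ (P : FinitePoset) where
    open FinitePoset P

    -- Distinct positions hold distinct sets, so `IsCopy` can be restated with equality of positions
    -- and without the sets paired with membership proofs.
    Embedding : Family n → Set
    Embedding G = ∃ λ (ψ : Fin size → Position) →
      (∀ x → ψ x ∈ positions G) ×
      (∀ {x y} → ψ x ≡ ψ y → x ≡ y) ×
      (∀ {i} → i ∈ positions G → ∃ λ x → ψ x ≡ i) ×
      (∀ {x y} → x ≼ y → set (ψ x) ⊆ set (ψ y))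

    embedding⇒copy : ∀ {G} → Embedding G → IsCopy P G
    embedding⇒copy (ψ , ψ∈ , inj , sur , mon) =
      (λ x → set (ψ x) , ψ x , ψ∈ x , refl) ,
      ((λ e → inj (set-injective e)) ,
       λ { (_ , i , i∈ , refl) → let x , e = sur i∈ in x , λ { refl → cong set e } }) ,
      λ x y → mon

    copy⇒embedding : ∀ {G} → IsCopy P G → Embedding G
    copy⇒embedding {G} (φ , (inj , sur) , mon) =
      ψ , (λ x → proj₁ (proj₂ (proj₂ (φ x)))) ,
      (λ {x} {y} e → inj (trans (sym (set-ψ x)) (trans (cong set e) (set-ψ y)))) ,
      (λ {i} i∈ → let x , e = sur (set i , i , i∈ , refl) in x , set-injective (trans (set-ψ x) (e refl))) ,
      λ {x} {y} x≼y → subst₂ _⊆_ (sym (set-ψ x)) (sym (set-ψ y)) (mon x y x≼y)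
      where
      ψ : Fin size → Position
      ψ x = proj₁ (proj₂ (φ x))

      set-ψ : ∀ x → set (ψ x) ≡ proj₁ (φ x)
      set-ψ x = proj₂ (proj₂ (proj₂ (φ x)))

  -- Copies of a diamond as two ends and a set of members between them.

  span : Position → Position → Subset (length (subsets n)) → Subset (length (subsets n))
  span a d S = ⁅ a ⁆ ∪ (⁅ d ⁆ ∪ S)

  a∈span : ∀ a d S → a ∈ span a d S
  a∈span a d S = x∈p∪q⁺ (inj₁ (x∈⁅x⁆ a))

  d∈span : ∀ a d S → d ∈ span a d S
  d∈span a d S = x∈p∪q⁺ {p = ⁅ a ⁆} (inj₂ (x∈p∪q⁺ (inj₁ (x∈⁅x⁆ d))))

  S⊆span : ∀ a d S → S ⊆ span a d S
  S⊆span a d S x∈ = x∈p∪q⁺ {p = ⁅ a ⁆} (inj₂ (x∈p∪q⁺ {p = ⁅ d ⁆} (inj₂ x∈)))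

  ∈span⁻ : ∀ a d S {x} → x ∈ span a d S → x ≡ a ⊎ x ≡ d ⊎ x ∈ S
  ∈span⁻ a d S x∈ with x∈p∪q⁻ ⁅ a ⁆ _ x∈
  ... | inj₁ x∈a = inj₁ (x∈⁅y⁆⇒x≡y a x∈a)
  ... | inj₂ x∈dS with x∈p∪q⁻ ⁅ d ⁆ S x∈dS
  ...   | inj₁ x∈d = inj₂ (inj₁ (x∈⁅y⁆⇒x≡y d x∈d))
  ...   | inj₂ x∈S = inj₂ (inj₂ x∈S)

  Between : Family n → Position → Position → Position → Set
  Between F a d b = b ∈ positions F × a ⊏ b × b ⊏ d

  Between? : ∀ F a d → Decidable (Between F a d)
  Between? F a d b = (b ∈? positions F) ×-dec (a ⊏? b) ×-dec (b ⊏? d)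

  between : Family n → Position → Position → Subset (length (subsets n))
  between F a d = comprehension (Between? F a d)

  Pair : Family n → Position × Position → Set
  Pair F (a , d) = a ∈ positions F × d ∈ positions F × a ⊏ d

  Pair? : ∀ F → Decidable (Pair F)
  Pair? F (a , d) = (a ∈? positions F) ×-dec (d ∈? positions F) ×-dec (a ⊏? d)

  pairs : Family n → List (Position × Position)
  pairs F = filter (Pair? F) (cartesianProduct (allFin _) (allFin _))

  ∈-pairs⁺ : ∀ {F a d} → Pair F (a , d) → (a , d) List.∈ pairs F
  ∈-pairs⁺ {F} {a} {d} p = ∈-filter⁺ (Pair? F) (∈-cartesianProduct⁺ (∈-allFin a) (∈-allFin d)) p

  ∈-pairs⁻ : ∀ {F p} → p List.∈ pairs F → Pair F p
  ∈-pairs⁻ {F} p∈ = proj₂ (∈-filter⁻ (Pair? F) {xs = cartesianProduct (allFin _) (allFin _)} p∈)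

  pairs-unique : ∀ F → Unique (pairs F)
  pairs-unique F = Unique.filter⁺ (Pair? F) (Unique.cartesianProduct⁺ (Unique.allFin⁺ _) (Unique.allFin⁺ _))

  -- Copies need not be induced, so any relations among the members of `S` are harmless; only their
  -- place between the ends matters.
  span-diamond : ∀ {F a d S} → a ⊏ d → S ⊆ between F a d →
                 Embedding (diamond ∣ S ∣) (family (span a d S))
  span-diamond {F} {a} {d} {S} a⊏d S⊆ = (λ x → ψ (diamondView x)) , ψ∈ , inj (diamondView _) (diamondView _) , sur , mon
    where
    ψ : ∀ {x : Fin (suc (suc ∣ S ∣))} → DiamondView x → Position
    ψ bottom     = a
    ψ (middle i) = nth S i
    ψ top        = d

    b : ∀ i → Between F a d (nth S i)
    b i = ∈-comprehension⁻ (Between? F a d) (S⊆ (nth-∈ S i))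

    ψ∈ : ∀ x → ψ (diamondView x) ∈ span a d S
    ψ∈ x with diamondView x
    ... | bottom   = a∈span a d S
    ... | middle i = S⊆span a d S (nth-∈ S i)
    ... | top      = d∈span a d S

    inj : ∀ {x y} (u : DiamondView x) (v : DiamondView y) → ψ u ≡ ψ v → x ≡ y
    inj bottom     bottom     _ = refl
    inj bottom     (middle i) e = ⊥-elim (proj₂ (proj₁ (proj₂ (b i))) (cong set e))
    inj bottom     top        e = ⊥-elim (proj₂ a⊏d (cong set e))
    inj (middle i) bottom     e = ⊥-elim (proj₂ (proj₁ (proj₂ (b i))) (cong set (sym e)))
    inj (middle i) (middle j) e = cong (suc ∘ inject₁) (nth-injective S e)
    inj (middle i) top        e = ⊥-elim (proj₂ (proj₂ (proj₂ (b i))) (cong set e))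
    inj top        bottom     e = ⊥-elim (proj₂ a⊏d (cong set (sym e)))
    inj top        (middle i) e = ⊥-elim (proj₂ (proj₂ (proj₂ (b i))) (cong set (sym e)))
    inj top        top        _ = refl

    sur : ∀ {i} → i ∈ span a d S → ∃ λ x → ψ (diamondView x) ≡ i
    sur {i} i∈ with ∈span⁻ a d S i∈
    ... | inj₁ refl        = zero , refl
    ... | inj₂ (inj₁ refl) = fromℕ _ , cong ψ (diamondView-top ∣ S ∣)
    ... | inj₂ (inj₂ i∈S)  = let j , e = nth-surjective S i∈S in
                             suc (inject₁ j) , trans (cong ψ (diamondView-middle j)) e

    a⊆ψ : ∀ {x} (v : DiamondView x) → set a ⊆ set (ψ v)
    a⊆ψ bottom     x∈ = x∈
    a⊆ψ (middle i) x∈ = proj₁ (proj₁ (proj₂ (b i))) x∈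
    a⊆ψ top        x∈ = proj₁ a⊏d x∈

    ψ⊆d : ∀ {x} (v : DiamondView x) → set (ψ v) ⊆ set d
    ψ⊆d bottom     x∈ = proj₁ a⊏d x∈
    ψ⊆d (middle i) x∈ = proj₁ (proj₂ (proj₂ (b i))) x∈
    ψ⊆d top        x∈ = x∈

    mon : ∀ {x y} → Diamond≤ ∣ S ∣ x y → set (ψ (diamondView x)) ⊆ set (ψ (diamondView y))
    mon ≤-refl   z∈ = z∈
    mon (a≤ {x}) z∈ = a⊆ψ (diamondView x) z∈
    mon (≤c {x}) z∈ rewrite diamondView-top ∣ S ∣ = ψ⊆d (diamondView x) z∈

  -- The ends are the images of a and c, and `S` is the rest of `G`. Monotonicity puts `S` between
  -- the ends, and injectivity makes the inclusions strict.
  diamond-span : ∀ {F} {l G} → G ⊆ᶠ F → Embedding (diamond l) G →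
    ∃ λ a → ∃ λ d → ∃ λ S → Pair F (a , d) × S ⊆ between F a d × ∣ S ∣ ≡ l × G ≡ family (span a d S)
  diamond-span {F} {l} {G} G⊆F (ψ , ψ∈ , inj , sur , mon) =
    a , d , S , (G⊆F (ψ∈ zero) , G⊆F (ψ∈ _) , a⊏ _ (λ ())) , S⊆ , ∣S∣≡l , cong family (⊆-antisym G⊆span span⊆G)
    where
    a d : Position
    a = ψ zero
    d = ψ (fromℕ (suc l))

    Inner? : Decidable (λ x → x ∈ positions G × x ≢ a × x ≢ d)
    Inner? x = (x ∈? positions G) ×-dec ¬? (x Fin.≟ a) ×-dec ¬? (x Fin.≟ d)

    S : Subset (length (subsets n))
    S = comprehension Inner?

    a⊏ : ∀ x → zero ≢ x → a ⊏ ψ x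
    a⊏ x 0≢x = ⊆∧≢⇒⊏ (mon a≤) (0≢x ∘ inj)

    S⊆ : S ⊆ between F a d
    S⊆ {x} x∈S with ∈-comprehension⁻ Inner? x∈S
    ... | x∈G , x≢a , x≢d with sur x∈G
    ...   | y , refl = ∈-comprehension⁺ (Between? F a d)
      (G⊆F x∈G , ⊆∧≢⇒⊏ (mon a≤) (x≢a ∘ sym) , ⊆∧≢⇒⊏ (mon ≤c) x≢d)

    inner : Fin l → Position
    inner i = ψ (suc (inject₁ i))

    inner-sur : ∀ {x} → x ∈ S → ∃ λ i → inner i ≡ x
    inner-sur {x} x∈S with ∈-comprehension⁻ Inner? x∈S
    ... | x∈G , x≢a , x≢d with sur x∈G
    ...   | y , e with diamondView y
    ...     | bottom   = ⊥-elim (x≢a (sym e))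
    ...     | middle i = i , e
    ...     | top      = ⊥-elim (x≢d (sym e))

    ∣S∣≡l : ∣ S ∣ ≡ l
    -- The images of b₁, ..., b_l exhaust `S` and do not repeat, which bounds its size from both
    -- sides.
    ∣S∣≡l = ℕ.≤-antisym
      (surjection⇒∣∣≤ S inner inner-sur)
      (injection⇒≤∣∣ S inner
        (λ i → ∈-comprehension⁺ Inner?
          ( ψ∈ _
          , (λ e → case inj e of λ ())
          , (λ e → Fin.fromℕ≢inject₁ (sym (Fin.suc-injective (inj e))))))
        (λ e → Fin.inject₁-injective (Fin.suc-injective (inj e))))

    G⊆span : positions G ⊆ span a d S
    G⊆span {x} x∈ with x Fin.≟ a | x Fin.≟ d
    ... | yes refl | _        = a∈span a d S
    ... | no _     | yes refl = d∈span a d S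
    ... | no x≢a   | no x≢d   = S⊆span a d S (∈-comprehension⁺ Inner? (x∈ , x≢a , x≢d))

    span⊆G : span a d S ⊆ positions G
    span⊆G x∈ with ∈span⁻ a d S x∈
    ... | inj₁ refl        = ψ∈ zero
    ... | inj₂ (inj₁ refl) = ψ∈ _
    ... | inj₂ (inj₂ x∈S)  = proj₁ (∈-comprehension⁻ Inner? x∈S)

  span⊆Family : ∀ {F a d S} → Pair F (a , d) → S ⊆ between F a d → family (span a d S) ⊆ᶠ F
  span⊆Family {F} {a} {d} {S} (a∈ , d∈ , _) S⊆ x∈ with ∈span⁻ a d S x∈
  ... | inj₁ refl        = a∈
  ... | inj₂ (inj₁ refl) = d∈
  ... | inj₂ (inj₂ x∈S)  = proj₁ (∈-comprehension⁻ (Between? F a d) (S⊆ x∈S))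

  span-bounds : ∀ {F a d S} → a ⊏ d → S ⊆ between F a d → ∀ {x} → x ∈ span a d S →
                set a ⊆ set x × set x ⊆ set d
  span-bounds {F} {a} {d} {S} (a⊆d , _) S⊆ x∈ with ∈span⁻ a d S x∈
  ... | inj₁ refl        = (λ z∈ → z∈) , a⊆d
  ... | inj₂ (inj₁ refl) = a⊆d , λ z∈ → z∈
  ... | inj₂ (inj₂ x∈S)  = let _ , (a⊆x , _) , (x⊆d , _) = ∈-comprehension⁻ (Between? F a d) (S⊆ x∈S) in a⊆x , x⊆d

  -- Members strictly between the ends differ from both ends, so in the second span they can only
  -- come from `S′`.
  span-⊆ : ∀ {F a d S S′} → S ⊆ between F a d → span a d S ≡ span a d S′ → S ⊆ S′
  span-⊆ {F} {a} {d} {S} {S′} S⊆ e {x} x∈S with ∈span⁻ a d S′ (subst (x ∈_) e (S⊆span a d S x∈S))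
  ... | inj₁ refl         = ⊥-elim (proj₂ (proj₁ (proj₂ (∈-comprehension⁻ (Between? F a d) (S⊆ x∈S)))) refl)
  ... | inj₂ (inj₁ refl)  = ⊥-elim (proj₂ (proj₂ (proj₂ (∈-comprehension⁻ (Between? F a d) (S⊆ x∈S)))) refl)
  ... | inj₂ (inj₂ x∈S′)  = x∈S′

  -- The ends are the least and the greatest member of the span, and antisymmetry makes these
  -- unique.
  span-ends : ∀ {F a d S a′ d′ S′} → a ⊏ d → S ⊆ between F a d → a′ ⊏ d′ → S′ ⊆ between F a′ d′ →
              span a d S ≡ span a′ d′ S′ → a ≡ a′ × d ≡ d′
  span-ends {F} {a} {d} {S} {a′} {d′} {S′} a⊏d S⊆ a′⊏d′ S′⊆ e =
    set-injective (⊆-antisym (proj₁ (bounds (a∈span a′ d′ S′))) (proj₁ (bounds′ (a∈span a d S)))) ,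
    set-injective (⊆-antisym (proj₂ (bounds′ (d∈span a d S))) (proj₂ (bounds (d∈span a′ d′ S′))))
    where
    bounds : ∀ {x} → x ∈ span a′ d′ S′ → set a ⊆ set x × set x ⊆ set d
    bounds {x} x∈ = span-bounds {F} {S = S} a⊏d S⊆ (subst (x ∈_) (sym e) x∈)
    bounds′ : ∀ {x} → x ∈ span a d S → set a′ ⊆ set x × set x ⊆ set d′
    bounds′ {x} x∈ = span-bounds {F} {S = S′} a′⊏d′ S′⊆ (subst (x ∈_) e x∈)

  -- Counting the copies of a diamond.

  copiesOver : Family n → ℕ → Position × Position → List (Family n)
  copiesOver F l (a , d) = map (λ S → family (span a d S)) (choose (between F a d) l)

  copies : Family n → ℕ → List (Family n)
  copies F l = concatMap (copiesOver F l) (pairs F)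

  ∈-copiesOver⁻ : ∀ {F l a d G} → G List.∈ copiesOver F l (a , d) →
    ∃ λ S → S ⊆ between F a d × ∣ S ∣ ≡ l × G ≡ family (span a d S)
  ∈-copiesOver⁻ {F} {l} {a} {d} G∈ with ∈-map⁻ (λ S → family (span a d S)) G∈
  ... | S , S∈ , G≡ = let S⊆ , e = choose-sound (between F a d) l S∈ in S , S⊆ , e , G≡

  -- A copy determines its pair by `span-ends`, and then its middle by `span-⊆`.
  copies-unique : ∀ F l → Unique (copies F l)
  copies-unique F l = concatMap-unique (copiesOver F l) (pairs-unique F) over! separate
    where
    over! : ∀ p → Unique (copiesOver F l p)
    over! (a , d) = unique (choose-unique M l) (λ S∈ → proj₁ (choose-sound M l S∈))
      where
      M : Subset (length (subsets n))
      M = between F a d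
      -- A set `S` that contains an end is not recovered from its span, so injectivity is available
      -- only inside `M` and the inclusion in `M` accompanies the recursion.
      unique : ∀ {Ss} → Unique Ss → (∀ {S} → S List.∈ Ss → S ⊆ M) → Unique (map (λ S → family (span a d S)) Ss)
      unique []          _ = []
      unique (S∉ ∷ Ss!) ⊆M = All.map⁺ (All.tabulate λ S′∈ e → All.lookup S∉ S′∈
          (⊆-antisym (span-⊆ (⊆M (here refl)) (cong positions e))
                     (span-⊆ (⊆M (there S′∈)) (sym (cong positions e)))))
        ∷ unique Ss! (⊆M ∘ there)

    separate : ∀ {p q G} → p List.∈ pairs F → q List.∈ pairs F →
               G List.∈ copiesOver F l p → G List.∈ copiesOver F l q → p ≡ q
    separate p∈ q∈ G∈p G∈q with ∈-copiesOver⁻ {F} {l} G∈p | ∈-copiesOver⁻ {F} {l} G∈q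
    ... | S , S⊆ , _ , refl | S′ , S′⊆ , _ , e =
      let a≡ , d≡ = span-ends {F} {S = S} {S′ = S′} (proj₂ (proj₂ (∈-pairs⁻ p∈))) S⊆ (proj₂ (proj₂ (∈-pairs⁻ q∈))) S′⊆ (cong positions e)
      in cong₂ _,_ a≡ d≡

  families-complete : ∀ F → F List.∈ families n
  families-complete F = ∈-map⁺ family (subsets-complete (positions F))

  families-unique : Unique (families n)
  families-unique = Unique.map⁺ (cong positions) (subsets-unique _)

  copiesOver-sound : ∀ F l {p G} → Pair F p → G List.∈ copiesOver F l p → G ⊆ᶠ F × IsCopy (diamond l) G
  copiesOver-sound F l {a , d} p G∈ = case ∈-copiesOver⁻ {F} {l} G∈ of λ where
    (S , S⊆ , refl , refl) → (λ {x} → span⊆Family {F} {S = S} p S⊆ {x}) ,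
      embedding⇒copy (diamond l) (span-diamond {F} {S = S} (proj₂ (proj₂ p)) S⊆)

  copiesOver-complete : ∀ F l {G} → G ⊆ᶠ F → IsCopy (diamond l) G →
                        ∃ λ p → Pair F p × G List.∈ copiesOver F l p
  copiesOver-complete F l {G} G⊆F copy = case diamond-span {F} {l} {G} G⊆F (copy⇒embedding (diamond l) copy) of λ where
    (a , d , S , p , S⊆ , ∣S∣≡l , refl) → (a , d) , p ,
      ∈-map⁺ (λ S → family (span a d S)) (choose-complete l S⊆ ∣S∣≡l)

  copy? : ∀ P (F : Family n) → Decidable (λ G → G ⊆ᶠ F × IsCopy P G)
  copy? P F G = (G ⊆ᶠ? F) ×-dec isCopy? P G

  -- The filtered list of families behind `c` and the list `copies F l` are both repetition-free and
  -- have the same members, hence equal lengths.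
  c-diamond : ∀ l F → c (diamond l) F ≡ sum (map (λ (a , d) → ∣ between F a d ∣ C l) (pairs F))
  c-diamond l F = trans c≡copies (trans (length-concatMap (copiesOver F l) (pairs F)) (cong sum (map-cong over (pairs F))))
    where
    over : ∀ p → length (copiesOver F l p) ≡ ∣ between F (proj₁ p) (proj₂ p) ∣ C l
    over (a , d) = trans (length-map _ (choose (between F a d) l)) (length-choose (between F a d) l)

    copies⊆ : ∀ {G} → G List.∈ copies F l → G List.∈ filter (copy? (diamond l) F) (families n)
    copies⊆ {G} G∈ =
      let p , p∈ , G∈p = List.find (∈-concatMap⁻ (copiesOver F l) {xs = pairs F} G∈)
      in ∈-filter⁺ (copy? (diamond l) F) (families-complete G) (copiesOver-sound F l (∈-pairs⁻ p∈) G∈p)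

    ⊆copies : ∀ {G} → G List.∈ filter (copy? (diamond l) F) (families n) → G List.∈ copies F l
    ⊆copies {G} G∈ =
      let _ , G⊆F , copy = ∈-filter⁻ (copy? (diamond l) F) {xs = families n} G∈
          p , p∈ , G∈p = copiesOver-complete F l (λ {x} → G⊆F {x}) copy
      in ∈-concatMap⁺ (copiesOver F l) (List.lose (∈-pairs⁺ p∈) G∈p)

    c≡copies : c (diamond l) F ≡ length (copies F l)
    c≡copies = ℕ.≤-antisym
      (unique-⊆⇒length≤ (Unique.filter⁺ (copy? (diamond l) F) families-unique) ⊆copies)
      (unique-⊆⇒length≤ (copies-unique F l) copies⊆)

  -- Freeness, short chains, and bounds on `La`.

  Free : ℕ → Family n → Set
  Free k F = ∀ {a d} → Pair F (a , d) → ∣ between F a d ∣ < k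

  -- A pair with at least `k` members between would add at least `k C k`, which is 1, to a sum that
  -- is 0.
  c≡0⇒free : ∀ k F → c (diamond k) F ≡ 0 → Free k F
  c≡0⇒free k F c≡0 {a} {d} p = ℕ.≰⇒> λ k≤ → ℕ.<⇒≢
    (ℕ.≤-trans (ℕ.≤-reflexive (sym (nCn≡1 k))) (C-monoˡ k k≤))
    (sym (sum-map≡0⇒ (λ (a , d) → ∣ between F a d ∣ C k) (trans (sym (c-diamond k F)) c≡0) (∈-pairs⁺ p)))

  free⇒c≡0 : ∀ k F → Free k F → c (diamond k) F ≡ 0
  free⇒c≡0 k F free = ℕ.n≤0⇒n≡0 (ℕ.≤-trans (ℕ.≤-reflexive (c-diamond k F))
    (ℕ.≤-trans (sum-map≤length* _ 0 (pairs F) (λ p∈ → ℕ.≤-reflexive (k>n⇒nCk≡0 (free (∈-pairs⁻ p∈)))))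
               (ℕ.≤-reflexive (ℕ.*-zeroʳ (length (pairs F))))))

  -- The linear order on the indices always contains the diamond order. The hypothesis is the
  -- reverse containment, which holds for `l ≤ 1`; the two notions of copy then agree.
  c-chain≡c-diamond : ∀ l F → (∀ x y → x Fin.≤ y → Diamond≤ l x y) →
                      c (chain (suc (suc l))) F ≡ c (diamond l) F
  c-chain≡c-diamond l F ≤⇒≼ = cong length (filter-≐ (copy? (chain (suc (suc l))) F) (copy? (diamond l) F)
    ((λ (G⊆F , φ , bij , mon) → (λ {x} → G⊆F {x}) , φ , bij , λ x y x≼y → mon x y (≼⇒≤ x≼y)) ,
     (λ (G⊆F , φ , bij , mon) → (λ {x} → G⊆F {x}) , φ , bij , λ x y x≤y → mon x y (≤⇒≼ x y x≤y)))
    (families n))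
    where
    ≼⇒≤ : ∀ {x y} → Diamond≤ l x y → x Fin.≤ y
    ≼⇒≤ ≤-refl   = ℕ.≤-refl
    ≼⇒≤ a≤       = z≤n
    ≼⇒≤ (≤c {x}) = Fin.≤fromℕ x

  c-chain₃ : ∀ F → c (chain 3) F ≡ c (diamond 1) F
  c-chain₃ F = c-chain≡c-diamond 1 F λ where
    zero          _                _        → a≤
    (suc _)       (suc (suc zero)) _        → ≤c
    (suc zero)    (suc zero)       _        → ≤-refl
    (suc (suc _)) (suc zero)       (s≤s ())

  c-chain₂ : ∀ F → c (chain 2) F ≡ length (pairs F)
  c-chain₂ F = trans
    (c-chain≡c-diamond 0 F λ { zero _ _ → a≤ ; (suc zero) (suc zero) _ → ≤-refl })
    (trans (c-diamond 0 F) (trans (cong sum (map-cong (λ (a , d) → nC0≡1 ∣ between F a d ∣) (pairs F))) (sum-ones (pairs F))))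
    where
    sum-ones : ∀ {A : Set} (xs : List A) → sum (map (λ _ → 1) xs) ≡ length xs
    sum-ones []       = refl
    sum-ones (_ ∷ xs) = cong suc (sum-ones xs)

  free⇒chain₃≡0 : ∀ F → (∀ {a b d} → a ∈ positions F → b ∈ positions F → d ∈ positions F → a ⊏ b → ¬ b ⊏ d) →
                  c (chain 3) F ≡ 0
  free⇒chain₃≡0 F no3 = trans (c-chain₃ F) (free⇒c≡0 1 F λ {a} {d} (a∈ , d∈ , _) →
    s≤s (surjection⇒∣∣≤ {m = 0} (between F a d) (λ ()) λ b∈ →
      let b∈F , a⊏b , b⊏d = ∈-comprehension⁻ (Between? F a d) b∈ in ⊥-elim (no3 a∈ b∈F d∈ a⊏b b⊏d)))

  La-≥ : ∀ P Q (F : Family n) → c P F ≡ 0 → c Q F ≤ La n P Q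
  La-≥ P Q F c≡0 = All.lookup (xs≤max 0 _)
    (∈-map⁺ (c Q) (∈-filter⁺ (λ F → c P F ℕ.≟ 0) (families-complete F) c≡0))

  -- The factor `b` stays on the left, so that a bound on a multiple of each count passes to the
  -- maximum without division.
  *La-≤ : ∀ P Q b v → (∀ (F : Family n) → c P F ≡ 0 → b * c Q F ≤ v) → b * La n P Q ≤ v
  *La-≤ P Q b v ≤v = argmax-all (λ x → x) {P = λ x → b * x ≤ v}
    -- The default value 0 of the maximum.
    (ℕ.≤-trans (ℕ.≤-reflexive (ℕ.*-zeroʳ b)) z≤n)
    (All.map⁺ (All.tabulate λ {F} F∈ → ≤v F (proj₂ (∈-filter⁻ (λ F → c P F ℕ.≟ 0) {xs = families n} F∈))))

  La-≤ : ∀ P Q v → (∀ (F : Family n) → c P F ≡ 0 → c Q F ≤ v) → La n P Q ≤ v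
  La-≤ P Q v ≤v = ℕ.≤-trans (ℕ.≤-reflexive (sym (ℕ.*-identityˡ _)))
    (*La-≤ P Q 1 v (λ F c≡0 → ℕ.≤-trans (ℕ.≤-reflexive (ℕ.*-identityˡ _)) (≤v F c≡0)))

  -- Layers of members of equal height.

  module Layers (F : Family n) where

    -- A chain of j + 1 members of F ends in x.
    Reach : ℕ → Position → Set
    Reach zero    x = x ∈ positions F
    Reach (suc j) x = x ∈ positions F × ∃ λ y → y ⊏ x × Reach j y

    reach? : ∀ j → Decidable (Reach j)
    reach? zero    x = x ∈? positions F
    reach? (suc j) x = (x ∈? positions F) ×-dec Fin.any? λ y → (y ⊏? x) ×-dec reach? j y

    reach-∈ : ∀ j {x} → Reach j x → x ∈ positions F
    reach-∈ zero    r = r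
    reach-∈ (suc j) r = proj₁ r

    -- Removes the least member of the chain, so that it still ends in `x`.
    reach-pred : ∀ j {x} → Reach (suc j) x → Reach j x
    reach-pred zero    (x∈ , _)           = x∈
    reach-pred (suc j) (x∈ , y , y⊏x , r) = x∈ , y , y⊏x , reach-pred j r

    reach-≤ : ∀ {i j x} → i ≤ j → Reach j x → Reach i x
    reach-≤ i≤j = go (ℕ.≤⇒≤′ i≤j)
      where
      go : ∀ {i j x} → i ≤′ j → Reach j x → Reach i x
      go (≤′-reflexive refl) r = r
      go (≤′-step i≤′j)      r = go i≤′j (reach-pred _ r)

    -- The witness `a` is the least of the `j + 2` members of the chain, and the other `j` lie
    -- between it and `x`. Passing from `y` to `x` keeps what was between and adds `y`.
    reach-between : ∀ j {x} → Reach (suc j) x → ∃ λ a → Pair F (a , x) × j ≤ ∣ between F a x ∣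
    reach-between zero    (x∈ , y , y⊏x , y∈) = y , (y∈ , x∈ , y⊏x) , z≤n
    reach-between (suc j) {x} (x∈ , y , y⊏x , r) with reach-between j r
    ... | a , (a∈ , y∈ , a⊏y) , j≤ = a , (a∈ , x∈ , ⊊-trans a⊏y y⊏x) ,
      ℕ.≤-<-trans j≤ (p⊂q⇒∣p∣<∣q∣
        ( (λ b∈ → let b∈F , a⊏b , b⊏y = ∈-comprehension⁻ (Between? F a y) b∈ in
                  ∈-comprehension⁺ (Between? F a x) (b∈F , a⊏b , ⊊-trans b⊏y y⊏x))
        , y , ∈-comprehension⁺ (Between? F a x) (y∈ , a⊏y , y⊏x)
        , λ y∈′ → proj₂ (proj₂ (proj₂ (∈-comprehension⁻ (Between? F a y) y∈′))) refl ))

    -- Height `i`: the longest chain of members ending in `x` has `i + 1` members.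
    Level : ℕ → Position → Set
    Level i x = Reach i x × ¬ Reach (suc i) x

    level? : ∀ i → Decidable (Level i)
    level? i x = reach? i x ×-dec ¬? (reach? (suc i) x)

    level-exists : ∀ k {x} → x ∈ positions F → ¬ Reach (suc k) x → ∃ λ i → i ≤ k × Level i x
    level-exists zero    x∈ ¬r = 0 , z≤n , x∈ , ¬r
    level-exists (suc k) {x} x∈ ¬r with reach? (suc k) x
    ... | yes r = suc k , ℕ.≤-refl , r , ¬r
    ... | no ¬r′ = let i , i≤k , lev = level-exists k x∈ ¬r′ in i , ℕ.m≤n⇒m≤1+n i≤k , lev

    -- Appending `y` to a chain that ends in `x` would make the height of `y` exceed `i`.
    level-antichain : ∀ {i x y} → Level i x → Level i y → ¬ x ⊏ y
    level-antichain {i} {x} (rx , _) (ry , ¬r) x⊏y = ¬r (reach-∈ i ry , x , x⊏y , rx)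

    Layers? : ∀ i j → Decidable (λ x → Level i x ⊎ Level j x)
    Layers? i j x = level? i x ⊎-dec level? j x

    layers : ℕ × ℕ → Family n
    layers (i , j) = family (comprehension (Layers? i j))

    -- Of three members of a chain two share a level, and a level is an antichain.
    layers-free : ∀ p → c (chain 3) (layers p) ≡ 0
    layers-free (i , j) = free⇒chain₃≡0 (layers (i , j)) λ a∈ b∈ d∈ → no3
      (∈-comprehension⁻ (Layers? i j) a∈) (∈-comprehension⁻ (Layers? i j) b∈) (∈-comprehension⁻ (Layers? i j) d∈)
      where
      no3 : ∀ {a b d} → Level i a ⊎ Level j a → Level i b ⊎ Level j b → Level i d ⊎ Level j d →
            a ⊏ b → ¬ b ⊏ d
      no3 (inj₁ a) (inj₁ b) _        a⊏b _   = level-antichain a b a⊏b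
      no3 (inj₂ a) (inj₂ b) _        a⊏b _   = level-antichain a b a⊏b
      no3 _        (inj₁ b) (inj₁ d) _   b⊏d = level-antichain b d b⊏d
      no3 _        (inj₂ b) (inj₂ d) _   b⊏d = level-antichain b d b⊏d
      no3 (inj₁ a) (inj₂ b) (inj₁ d) a⊏b b⊏d = level-antichain a d (⊊-trans a⊏b b⊏d)
      no3 (inj₂ a) (inj₁ b) (inj₂ d) a⊏b b⊏d = level-antichain a d (⊊-trans a⊏b b⊏d)

-- Pairs of heights `i`, `j` with `i + 2 ≤ j ≤ k`.

distantPairs : ℕ → List (ℕ × ℕ)
distantPairs zero    = []
distantPairs (suc k) = distantPairs k ++ map (_, suc k) (upTo k)

-- Of the `(k + 1) C 2` pairs `i < j ≤ k`, exactly `k` are consecutive. The induction `count` adds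
-- these back, which avoids truncated subtraction.
length-distantPairs : ∀ k → length (distantPairs k) ≡ ((k + 1) C 2) ∸ k
length-distantPairs k = trans (sym (ℕ.m+n∸n≡m _ k)) (cong (_∸ k) (trans (count k) (cong (_C 2) (ℕ.+-comm 1 k))))
  where
  open ℕ.≤-Reasoning
  count : ∀ k → length (distantPairs k) + k ≡ suc k C 2
  count zero    = refl
  count (suc k) = begin-equality
    length (distantPairs k ++ map (_, suc k) (upTo k)) + suc k
      ≡⟨ cong (_+ suc k) (trans (length-++ (distantPairs k)) (cong (length (distantPairs k) +_) (trans (length-map _ (upTo k)) (length-upTo k)))) ⟩
    length (distantPairs k) + k + suc k  ≡⟨ cong (_+ suc k) (count k) ⟩
    suc k C 2 + suc k                    ≡⟨ ℕ.+-comm (suc k C 2) (suc k) ⟩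
    suc k + suc k C 2                    ≡⟨ cong (_+ suc k C 2) (nC1≡n (suc k)) ⟨
    suc k C 1 + suc k C 2                ≡⟨ nCk+nC[k+1]≡[n+1]C[k+1] (suc k) 1 ⟩
    suc (suc k) C 2                      ∎

∈-distantPairs : ∀ {i j} k → suc i < j → j ≤ k → (i , j) List.∈ distantPairs k
∈-distantPairs zero () z≤n
∈-distantPairs {i} {j} (suc k) i+1<j j≤ with ℕ.m≤n⇒m<n∨m≡n j≤
... | inj₁ (s≤s j≤k) = ∈-++⁺ˡ (∈-distantPairs k i+1<j j≤k)
... | inj₂ refl      = ∈-++⁺ʳ (distantPairs k) (∈-map⁺ (_, suc k) (∈-upTo⁺ (ℕ.≤-pred i+1<j)))

-- The upper bound.

module _ {n : ℕ} where
  open Ground n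

  upper-bound : ∀ k l → 1 ≤ l → (F : Family n) → c (diamond k) F ≡ 0 →
    c (diamond l) F ≤ ((k ∸ 1) C l) * (length (distantPairs k) * La n (chain 3) (chain 2))
  upper-bound k l 1≤l F c≡0 = begin
    c (diamond l) F
      ≡⟨ c-diamond l F ⟩
    sum (map (λ (a , d) → ∣ between F a d ∣ C l) (pairs F))
      ≤⟨ sum-map≤ crossed? (λ (a , d) → ∣ between F a d ∣ C l) ((k ∸ 1) C l) (pairs F)
           (λ p∈ → C-monoˡ l (ℕ.∸-monoˡ-≤ 1 (free (∈-pairs⁻ p∈)))) (λ {p} → uncrossed p) ⟩
    ((k ∸ 1) C l) * length (filter crossed? (pairs F))
      -- Each pair with a member between is also a pair of some family `layers p`. Pairs that occur
      -- for several `p` only enlarge the right side.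
      ≤⟨ ℕ.*-monoʳ-≤ ((k ∸ 1) C l) (unique-⊆⇒length≤ (Unique.filter⁺ crossed? (pairs-unique F)) crossed⊆) ⟩
    ((k ∸ 1) C l) * length (concatMap (pairs ∘ layers) (distantPairs k))
      ≤⟨ ℕ.*-monoʳ-≤ ((k ∸ 1) C l) (ℕ.≤-trans
           (ℕ.≤-reflexive (length-concatMap (pairs ∘ layers) (distantPairs k)))
           (sum-map≤length* (length ∘ pairs ∘ layers) (La n (chain 3) (chain 2)) (distantPairs k) λ {p} _ → pairs≤La p)) ⟩
    ((k ∸ 1) C l) * (length (distantPairs k) * La n (chain 3) (chain 2))
      ∎
    where
    open ℕ.≤-Reasoning
    open Layers F

    pairs≤La : ∀ p → length (pairs (layers p)) ≤ La n (chain 3) (chain 2)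
    pairs≤La p = subst (_≤ La n (chain 3) (chain 2)) (c-chain₂ (layers p))
      (La-≥ (chain 3) (chain 2) (layers p) (layers-free p))

    free : Free k F
    free = c≡0⇒free k F c≡0

    Crossed : Position × Position → Set
    Crossed (a , d) = Nonempty (between F a d)

    crossed? : Decidable Crossed
    crossed? (a , d) = nonempty? (between F a d)

    uncrossed : ∀ p → ¬ Crossed p → ∣ between F (proj₁ p) (proj₂ p) ∣ C l ≡ 0
    uncrossed (a , d) empty = k>n⇒nCk≡0 (ℕ.≤-<-trans
      (surjection⇒∣∣≤ {m = 0} (between F a d) (λ ()) λ b∈ → ⊥-elim (empty (_ , b∈))) 1≤l)

    level : ∀ {x} → x ∈ positions F → ∃ λ i → i ≤ k × Level i x
    -- A chain of `k + 2` members would have `k` members between its ends, contrary to freeness.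
    level x∈ = level-exists k x∈ λ r → let a , p , k≤ = reach-between k r in ℕ.<⇒≱ (free p) k≤

    crossed-layers : ∀ {a b d} → Pair F (a , d) → Between F a d b →
                     ∃ λ p → p List.∈ distantPairs k × Pair (layers p) (a , d)
    crossed-layers {a} {b} (a∈ , d∈ , a⊏d) (b∈ , a⊏b , b⊏d) =
      let i , _   , levelᵃ = level a∈
          j , j≤k , levelᵈ = level d∈
      in (i , j) ,
         -- A longest chain ending in `a`, continued by `b` and `d`, gives `d` height at least
         -- `i + 2`; with `j ≤ i + 1` this contradicts height `j`.
         ∈-distantPairs k (ℕ.≰⇒> λ j≤ → proj₂ levelᵈ
           (reach-≤ (s≤s j≤) (d∈ , b , b⊏d , b∈ , a , a⊏b , proj₁ levelᵃ))) j≤k ,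
         ∈-comprehension⁺ (Layers? i j) (inj₁ levelᵃ) ,
         ∈-comprehension⁺ (Layers? i j) (inj₂ levelᵈ) , a⊏d

    crossed⊆ : ∀ {p} → p List.∈ filter crossed? (pairs F) →
               p List.∈ concatMap (pairs ∘ layers) (distantPairs k)
    crossed⊆ {a , d} p∈ =
      let p∈F , b , b∈ = ∈-filter⁻ crossed? {xs = pairs F} p∈
          q , q∈ , p∈q = crossed-layers {a} {b} {d} (∈-pairs⁻ p∈F) (∈-comprehension⁻ (Between? F a d) b∈)
      in ∈-concatMap⁺ (pairs ∘ layers) (List.lose q∈ (∈-pairs⁺ p∈q))

La-diamond≤ : ∀ k l n → 1 ≤ l →
  La n (diamond k) (diamond l) ≤ ((((k + 1) C 2) ∸ k) * ((k ∸ 1) C l)) * La n (chain 3) (chain 2)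
La-diamond≤ k l n 1≤l = Ground.La-≤ n (diamond k) (diamond l) _ λ F c≡0 →
  subst (c (diamond l) F ≤_) rearrange (upper-bound k l 1≤l F c≡0)
  where
  rearrange : ((k ∸ 1) C l) * (length (distantPairs k) * La n (chain 3) (chain 2)) ≡
              ((((k + 1) C 2) ∸ k) * ((k ∸ 1) C l)) * La n (chain 3) (chain 2)
  rearrange = trans (sym (ℕ.*-assoc ((k ∸ 1) C l) (length (distantPairs k)) _))
    (cong (_* La n (chain 3) (chain 2))
      (trans (ℕ.*-comm ((k ∸ 1) C l) _) (cong (_* ((k ∸ 1) C l)) (length-distantPairs k))))

-- The blow-up of a P₃-free family by `K` new points.

module BlowUp (K : ℕ) {m : ℕ} (F : Family m) (F-P₃-free : c (chain 3) F ≡ 0) where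
  private
    module G  = Ground m
    module G′ = Ground (K + m)

  Member : Subset m → Set
  Member D = G.position D ∈ positions F

  member : ∀ {x} → x ∈ positions F → Member (G.set x)
  member {x} x∈ = subst (_∈ positions F) (sym (G.set-injective (G.set-position (G.set x)))) x∈

  -- P₃ is D₁, so freeness leaves no member between `A` and `D`, whereas `B` would be one.
  no-3-chain : ∀ {A B D} → Member A → Member B → Member D → A ⊊ B → ¬ B ⊊ D
  no-3-chain {A} {B} {D} A∈ B∈ D∈ A⊊B B⊊D = ℕ.<⇒≱
    (G.c≡0⇒free 1 F (trans (sym (G.c-chain₃ F)) F-P₃-free) (A∈ , D∈ , lift (⊊-trans A⊊B B⊊D)))
    (injection⇒≤∣∣ {m = 1} (G.between F (G.position A) (G.position D)) (λ _ → G.position B)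
      (λ _ → ∈-comprehension⁺ (G.Between? F (G.position A) (G.position D)) (B∈ , lift A⊊B , lift B⊊D))
      (λ { {zero} {zero} _ → refl }))
    where
    lift : ∀ {A B} → A ⊊ B → G.position A G.⊏ G.position B
    lift {A} {B} = subst₂ _⊊_ (sym (G.set-position A)) (sym (G.set-position B))

  Lower Upper : Subset m → Set
  Lower A = ∃ λ j → j ∈ positions F × A ⊊ G.set j
  Upper D = ∃ λ j → j ∈ positions F × G.set j ⊊ D

  -- `Y` is the part on the new points, which come first, and `D` the part on the old ones. A member
  -- of `F` comparable to no other yields no set; it lies in no copy of P₂.
  Blown : Subset K → Subset m → Set
  Blown Y D = Member D × ((Lower D × (Y ≡ ⊥ ⊎ ∃ λ i → Y ≡ ⁅ i ⁆)) ⊎ (Upper D × Y ≡ ⊤))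

  blown? : ∀ Y D → Dec (Blown Y D)
  blown? Y D = (G.position D ∈? positions F) ×-dec
    ((Fin.any? (λ j → (j ∈? positions F) ×-dec (D ⊊? G.set j)) ×-dec
      ((Y ≟ˢ ⊥) ⊎-dec Fin.any? (λ i → Y ≟ˢ ⁅ i ⁆)))
     ⊎-dec
     (Fin.any? (λ j → (j ∈? positions F) ×-dec (G.set j ⊊? D)) ×-dec (Y ≟ˢ ⊤)))

  new : G′.Position → Subset K
  new x = Vec.take K (G′.set x)

  old : G′.Position → Subset m
  old x = Vec.drop K (G′.set x)

  new++old : ∀ x → new x Vec.++ old x ≡ G′.set x
  new++old x = Vec.take++drop≡id K (G′.set x)

  InBlowUp? : Decidable (λ x → Blown (new x) (old x))
  InBlowUp? x = blown? (new x) (old x)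

  blowUp : Family (K + m)
  blowUp = family (comprehension InBlowUp?)

  ∈-blowUp⁺ : ∀ {Y D} → Blown Y D → G′.position (Y Vec.++ D) ∈ positions blowUp
  ∈-blowUp⁺ {Y} {D} b =
    let Y≡ , D≡ = Vec.++-injective _ Y (trans (new++old _) (G′.set-position (Y Vec.++ D)))
    in ∈-comprehension⁺ InBlowUp? (subst₂ Blown (sym Y≡) (sym D≡) b)

  ⊏⇒⊆ : ∀ x y → x G′.⊏ y → new x ⊆ new y × old x ⊆ old y
  ⊏⇒⊆ x y (x⊆y , _) = ++-⊆⁻ (new x) (new y) (subst₂ _⊆_ (sym (new++old x)) (sym (new++old y)) x⊆y)

  ⊏⇒≢ : ∀ x y → x G′.⊏ y → new x ≡ new y → ¬ old x ≡ old y
  ⊏⇒≢ x y (_ , x≢y) new≡ old≡ = x≢y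
    (trans (sym (new++old x)) (trans (cong₂ Vec._++_ new≡ old≡) (new++old y)))

  ++-⊊ : ∀ (Y Y′ : Subset K) {D D′ : Subset m} → Y ⊆ Y′ → D ⊆ D′ → ¬ (Y ≡ Y′ × D ≡ D′) →
         G′.position (Y Vec.++ D) G′.⊏ G′.position (Y′ Vec.++ D′)
  ++-⊊ Y Y′ Y⊆ D⊆ ≢ = subst₂ _⊊_ (sym (G′.set-position _)) (sym (G′.set-position _))
    (++-⊆⁺ Y Y′ Y⊆ D⊆ , ≢ ∘ Vec.++-injective Y Y′)

  singletons : Subset m → Fin K → G′.Position
  singletons D i = G′.position (⁅ i ⁆ Vec.++ D)

  -- The member `z` is determined by `old x` and one new point, so at most `K` members lie between
  -- `x` and `y`.
  between⇒singleton : ∀ {x y z} → G′.Pair blowUp (x , y) → G′.Between blowUp x y z →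
                      ∃ λ i → singletons (old x) i ≡ z
  between⇒singleton {x} {y} {z} (x∈ , y∈ , _) (z∈ , x⊏z , z⊏y) =
    locate (∈-comprehension⁻ InBlowUp? x∈) (∈-comprehension⁻ InBlowUp? y∈) (∈-comprehension⁻ InBlowUp? z∈)
    where
    locate : Blown (new x) (old x) → Blown (new y) (old y) → Blown (new z) (old z) →
             ∃ λ i → singletons (old x) i ≡ z
    -- If `new z` is full, so is `new y`. Then `old z` is properly below `old y` and properly above
    -- the member at `j`, a chain of three in `F`.
    locate _ (Dʸ , _) (Dᶻ , inj₂ ((j , j∈ , j⊊z) , new≡⊤)) = ⊥-elim
      (no-3-chain (member j∈) Dᶻ Dʸ j⊊z (proj₂ (⊏⇒⊆ z y z⊏y) , ⊏⇒≢ z y z⊏y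
        (⊆-antisym (proj₁ (⊏⇒⊆ z y z⊏y)) (λ _ → subst (_ ∈_) (sym new≡⊤) ∈⊤))))
    locate (Dˣ , _) _ (Dᶻ , inj₁ ((j , j∈ , z⊊j) , shape)) with old x ≟ˢ old z | shape
    -- Otherwise `old z` lies below the member at `j`, so `old x` cannot be properly below `old z`.
    ... | no old≢  | _               = ⊥-elim (no-3-chain Dˣ Dᶻ (member j∈) (proj₂ (⊏⇒⊆ x z x⊏z) , old≢) z⊊j)
    -- With equal old parts, an empty `new z` would force `x` and `z` to hold the same set; only
    -- singletons remain.
    ... | yes old≡ | inj₁ new≡⊥      = ⊥-elim (⊏⇒≢ x z x⊏z
      (⊆-antisym (proj₁ (⊏⇒⊆ x z x⊏z)) (λ y∈ → ⊥-elim (∉⊥ (subst (_ ∈_) new≡⊥ y∈)))) old≡)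
    ... | yes old≡ | inj₂ (i , new≡) = i , G′.set-injective
      (trans (G′.set-position _) (trans (cong₂ Vec._++_ (sym new≡) old≡) (new++old z)))

  blowUp-free : c (diamond (suc K)) blowUp ≡ 0
  blowUp-free = G′.free⇒c≡0 (suc K) blowUp λ {x} {y} p → s≤s
    (surjection⇒∣∣≤ (G′.between blowUp x y) (singletons (old x))
      (λ z∈ → between⇒singleton p (∈-comprehension⁻ (G′.Between? blowUp x y) z∈)))

  lift : G.Position × G.Position → G′.Position × G′.Position
  lift (a , d) = G′.position (⊥ Vec.++ G.set a) , G′.position (⊤ Vec.++ G.set d)

  position-++-injective : ∀ (Y Y′ : Subset K) {D D′ : Subset m} →
    G′.position (Y Vec.++ D) ≡ G′.position (Y′ Vec.++ D′) → Y ≡ Y′ × D ≡ D′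
  position-++-injective Y Y′ e = Vec.++-injective Y Y′
    (trans (sym (G′.set-position _)) (trans (cong G′.set e) (G′.set-position _)))

  lift-injective : ∀ {p q} → lift p ≡ lift q → p ≡ q
  lift-injective e = cong₂ _,_
    (G.set-injective (proj₂ (position-++-injective ⊥ ⊥ (cong proj₁ e))))
    (G.set-injective (proj₂ (position-++-injective ⊤ ⊤ (cong proj₂ e))))

  ⊥≢⁅⁆ : (i : Fin K) → ⊥ ≢ ⁅ i ⁆
  ⊥≢⁅⁆ i e = ∉⊥ (subst (i ∈_) (sym e) (x∈⁅x⁆ i))

  ⁅⁆-injective : {i j : Fin K} → ⁅ i ⁆ ≡ ⁅ j ⁆ → i ≡ j
  ⁅⁆-injective {i} {j} e = x∈⁅y⁆⇒x≡y j (subst (i ∈_) e (x∈⁅x⁆ i))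

  lift-pair : ∀ {p} → G.Pair F p → G′.Pair blowUp (lift p)
  lift-pair {a , d} (a∈ , d∈ , a⊏d) =
    ∈-blowUp⁺ (member a∈ , inj₁ ((d , d∈ , a⊏d) , inj₁ refl)) ,
    ∈-blowUp⁺ (member d∈ , inj₂ ((a , a∈ , a⊏d) , refl)) ,
    ++-⊊ ⊥ ⊤ (⊆-min ⊤) (proj₁ a⊏d) (proj₂ a⊏d ∘ proj₂)

  lift-between : ∀ {a d} → G.Pair F (a , d) →
    K ≤ ∣ G′.between blowUp (proj₁ (lift (a , d))) (proj₂ (lift (a , d))) ∣
  lift-between {a} {d} (a∈ , d∈ , a⊏d) = injection⇒≤∣∣ _ (singletons (G.set a))
    (λ i → ∈-comprehension⁺ (G′.Between? blowUp _ _)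
      ( ∈-blowUp⁺ (member a∈ , inj₁ ((d , d∈ , a⊏d) , inj₂ (i , refl)))
      , ++-⊊ ⊥ ⁅ i ⁆ (⊆-min ⁅ i ⁆) (λ z∈ → z∈) (⊥≢⁅⁆ i ∘ proj₁)
      -- For `K = 1` the singleton is all of the new points, so strictness is taken from the old
      -- parts.
      , ++-⊊ ⁅ i ⁆ ⊤ (⊆-max ⁅ i ⁆) (proj₁ a⊏d) (proj₂ a⊏d ∘ proj₂)))
    (λ {i} {j} e → ⁅⁆-injective (proj₁ (position-++-injective ⁅ i ⁆ ⁅ j ⁆ e)))

  width : G′.Position × G′.Position → ℕ
  width (x , y) = ∣ G′.between blowUp x y ∣

  Wide : G′.Position × G′.Position → Set
  Wide p = K ≤ width p

  wide? : Decidable Wide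
  wide? p = K ≤? width p

  lifts⊆ : ∀ {q} → q List.∈ map lift (G.pairs F) → q List.∈ filter wide? (G′.pairs blowUp)
  lifts⊆ q∈ =
    let p , p∈ , q≡ = ∈-map⁻ lift q∈
    in subst (List._∈ filter wide? (G′.pairs blowUp)) (sym q≡)
         (∈-filter⁺ wide? (G′.∈-pairs⁺ (lift-pair (G.∈-pairs⁻ p∈))) (lift-between (G.∈-pairs⁻ p∈)))

  -- The pairs of `F` lift injectively to pairs with at least `K` members between, and each of these
  -- carries at least `K C l` copies.
  ≤c-blowUp : ∀ l → (K C l) * c (chain 2) F ≤ c (diamond l) blowUp
  ≤c-blowUp l = ℕ.≤-trans (ℕ.*-monoʳ-≤ (K C l) chains≤) ≤copies
    where
    chains≤ : c (chain 2) F ≤ length (filter wide? (G′.pairs blowUp))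
    chains≤ = subst (_≤ length (filter wide? (G′.pairs blowUp)))
      (trans (length-map lift (G.pairs F)) (sym (G.c-chain₂ F)))
      (unique-⊆⇒length≤ (Unique.map⁺ lift-injective (G.pairs-unique F)) lifts⊆)

    ≤copies : (K C l) * length (filter wide? (G′.pairs blowUp)) ≤ c (diamond l) blowUp
    ≤copies = subst ((K C l) * length (filter wide? (G′.pairs blowUp)) ≤_) (sym (G′.c-diamond l blowUp))
      (≤sum-map wide? (λ p → width p C l) (K C l) (G′.pairs blowUp) (λ {p} K≤ → C-monoˡ l {K} {width p} K≤))

-- The lower bound and the theorem.

≤La-diamond : ∀ K l m → (K C l) * La m (chain 3) (chain 2) ≤ La (K + m) (diamond (suc K)) (diamond l)
≤La-diamond K l m = Ground.*La-≤ m (chain 3) (chain 2) (K C l) _ λ F c≡0 →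
  let open BlowUp K F c≡0
  in ℕ.≤-trans (≤c-blowUp l) (Ground.La-≥ (K + m) (diamond (suc K)) (diamond l) blowUp blowUp-free)

theorem1p6 : ∀ (k l n : ℕ) → l < k → 1 ≤ l → k ∸ 1 ≤ n →
    (((k ∸ 1) C l) * La (n ∸ (k ∸ 1)) (chain 3) (chain 2) ≤ La n (diamond k) (diamond l))
    × (La n (diamond k) (diamond l) ≤ ((((k + 1) C 2) ∸ k) * ((k ∸ 1) C l)) * La n (chain 3) (chain 2))
theorem1p6 k l n l<k 1≤l k∸1≤n = lower , La-diamond≤ k l n 1≤l
  where
  suc[k∸1]≡k : suc (k ∸ 1) ≡ k
  suc[k∸1]≡k = ℕ.m+[n∸m]≡n (ℕ.≤-trans (s≤s z≤n) l<k)

  lower : ((k ∸ 1) C l) * La (n ∸ (k ∸ 1)) (chain 3) (chain 2) ≤ La n (diamond k) (diamond l)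
  -- The blow-up lives on `(k ∸ 1) + (n ∸ (k ∸ 1))` points and avoids the diamond of index
  -- `suc (k ∸ 1)`. The hypotheses make both subtractions exact, so these are `n` and `k`.
  lower = subst₂ (λ N j → ((k ∸ 1) C l) * La (n ∸ (k ∸ 1)) (chain 3) (chain 2) ≤ La N (diamond j) (diamond l))
    (ℕ.m+[n∸m]≡n k∸1≤n) suc[k∸1]≡k (≤La-diamond (k ∸ 1) l (n ∸ (k ∸ 1)))
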